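{- Let $\mathcal{H}$ be a family of graphs. There is a constant $C=C(\mathcal{H})$ such that $$\#\{v\in V(G):\deg(v)\ge 2\}\le C$$ for every $\mathcal{H}$-free graph $G$ if and only if $$\mathcal{H}\le\{K_n,\ nP_3,\ nK_3,\ K_{1,n}^*,\ K_{2,n},\ K_2+nK_1,\ K_1+nK_2\}$$ for some positive integer $n$.
   Context: All graphs are finite, undirected and simple (not necessarily connected). For graphs $H_1,H_2$, write $H_1\le H_2$ if $H_1$ is (isomorphic to) an induced subgraph of $H_2$. A graph $G$ is $\mathcal{H}$-free if there is no $H\in\mathcal{H}$ with $H\le G$. For families of graphs $\mathcal{H}_1,\mathcal{H}_2$, write $\mathcal{H}_1\le\mathcal{H}_2$ if for every $H_2\in\mathcal{H}_2$ there is $H_1\in\mathcal{H}_1$ with $H_1\le H_2$. $K_n$ is the complete graph on $n$ vertices, $P_n$ the path on $n$ vertices, $K_{s,t}$ the complete bipartite graph. $G_1+G_2$ denotes the join of $G_1$ and $G_2$: the graph with vertex set $V(G_1)\sqcup V(G_2)$ whose edges are those of $G_1$, those of $G_2$, and all pairs $\{x,y\}$ with $x\in V(G_1)$, $y\in V(G_2)$. $nG$ denotes the disjoint union of $n$ copies of $G$ (in $G_1+nG_2$ this is formed before the join). $K_{1,n}^*$ is the graph obtained from the star $K_{1,n}$ by attaching one pendant vertex to each of its $n$ leaves. -}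

module Defs where

open import Data.Bool using (Bool; true; false; not; _∧_; _∨_)
open import Data.Bool.Properties using (∨-comm)
open import Data.Fin using (Fin; toℕ; splitAt; remQuot; _↑ʳ_)
import Data.Fin as Fin
open import Data.Fin.Subset using (Subset; ∣_∣)
open import Data.Nat using (ℕ; suc; _+_; _*_)
import Data.Nat as ℕ
open import Data.Nat.Properties using (1+n≢n)
open import Data.Product using (_×_; _,_; ∃)
open import Data.Sum using (_⊎_; inj₁; inj₂)
open import Data.Vec using (tabulate)
open import Function using (_∘_; mk⇔)
open import Function.Definitions using (Injective)
open import Level using (Level; _⊔_)
open import Relation.Binary.PropositionalEquality
open import Relation.Nullary using (¬_; does)
open import Relation.Nullary.Decidable using (dec-true; dec-false; does-⇔)
open import Relation.Unary using (Pred; _∈_)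

private variable
  a b : Level

-- Finite simple graphs, with vertex set Fin order.
record Graph : Set where
  field
    order      : ℕ
    adj        : Fin order → Fin order → Bool
    adj-sym    : ∀ i j → adj i j ≡ adj j i
    adj-irrefl : ∀ i → adj i i ≡ false

open Graph public

Vertex : Graph → Set
Vertex G = Fin (order G)

neighbours : (G : Graph) → Vertex G → Subset (order G)
neighbours G v = tabulate (adj G v)

deg : (G : Graph) → Vertex G → ℕ
deg G v = ∣ neighbours G v ∣

#deg≥2 : Graph → ℕ
#deg≥2 G = ∣ tabulate (λ v → does (2 ℕ.≤? deg G v)) ∣

infix 4 _≤ᵍ_ _≤ᶠ_

-- H ≤ᵍ G: H is isomorphic to an induced subgraph of G.
record _≤ᵍ_ (H G : Graph) : Set where
  field
    embed     : Vertex H → Vertex G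
    injective : Injective _≡_ _≡_ embed
    induced   : ∀ i j → adj G (embed i) (embed j) ≡ adj H i j

-- Families are arbitrary predicates: possibly infinite, and not assumed to be
-- decidable or closed under isomorphism.
Family : ∀ a → Set (Level.suc a)
Family a = Pred Graph a

_isFreeOf_ : Graph → Family a → Set a
G isFreeOf ℋ = ¬ (∃ λ H → H ∈ ℋ × H ≤ᵍ G)

_≤ᶠ_ : Family a → Family b → Set (a ⊔ b)
ℋ₁ ≤ᶠ ℋ₂ = ∀ H₂ → H₂ ∈ ℋ₂ → ∃ λ H₁ → H₁ ∈ ℋ₁ × H₁ ≤ᵍ H₂

private
  =ᵇ-sym : ∀ {n} (i j : Fin n) → does (i Fin.≟ j) ≡ does (j Fin.≟ i)
  =ᵇ-sym i j = does-⇔ (mk⇔ sym sym) (i Fin.≟ j) (j Fin.≟ i)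

-- The graph on Fin k in which i and j are adjacent when e relates their labels.
labelled : ∀ {k} {V : Set} (label : Fin k → V) (e : V → V → Bool) →
           (∀ x y → e x y ≡ e y x) → (∀ x → e x x ≡ false) → Graph
labelled {k} label e e-sym e-irrefl = record
  { order      = k
  ; adj        = λ i j → e (label i) (label j)
  ; adj-sym    = λ i j → e-sym (label i) (label j)
  ; adj-irrefl = λ i → e-irrefl (label i)
  }

K : ℕ → Graph
K n = record
  { order      = n
  ; adj        = λ i j → not (does (i Fin.≟ j))
  ; adj-sym    = λ i j → cong not (=ᵇ-sym i j)
  ; adj-irrefl = λ i → cong not (dec-true (i Fin.≟ i) refl)
  }

P : ℕ → Graph
P n = labelled {n} toℕ consecutive
  (λ x y → ∨-comm (does (suc x ℕ.≟ y)) (does (suc y ℕ.≟ x)))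
  (λ x → cong₂ _∨_ (dec-false (suc x ℕ.≟ x) 1+n≢n) (dec-false (suc x ℕ.≟ x) 1+n≢n))
  where
  consecutive : ℕ → ℕ → Bool
  consecutive x y = does (suc x ℕ.≟ y) ∨ does (suc y ℕ.≟ x)

K[_,_] : ℕ → ℕ → Graph
K[ s , t ] = labelled (splitAt s {t}) e e-sym e-irrefl
  where
  e : Fin s ⊎ Fin t → Fin s ⊎ Fin t → Bool
  e (inj₁ _) (inj₁ _) = false
  e (inj₁ _) (inj₂ _) = true
  e (inj₂ _) (inj₁ _) = true
  e (inj₂ _) (inj₂ _) = false

  e-sym : ∀ x y → e x y ≡ e y x
  e-sym (inj₁ _) (inj₁ _) = refl
  e-sym (inj₁ _) (inj₂ _) = refl
  e-sym (inj₂ _) (inj₁ _) = refl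
  e-sym (inj₂ _) (inj₂ _) = refl

  e-irrefl : ∀ x → e x x ≡ false
  e-irrefl (inj₁ _) = refl
  e-irrefl (inj₂ _) = refl

infixl 6 _+ᵍ_
infixl 7 _·_

-- The join of two graphs (not their disjoint union).
_+ᵍ_ : Graph → Graph → Graph
G₁ +ᵍ G₂ = labelled (splitAt (order G₁) {order G₂}) e e-sym e-irrefl
  where
  e : Vertex G₁ ⊎ Vertex G₂ → Vertex G₁ ⊎ Vertex G₂ → Bool
  e (inj₁ x) (inj₁ y) = adj G₁ x y
  e (inj₁ _) (inj₂ _) = true
  e (inj₂ _) (inj₁ _) = true
  e (inj₂ x) (inj₂ y) = adj G₂ x y

  e-sym : ∀ x y → e x y ≡ e y x
  e-sym (inj₁ x) (inj₁ y) = adj-sym G₁ x y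
  e-sym (inj₁ _) (inj₂ _) = refl
  e-sym (inj₂ _) (inj₁ _) = refl
  e-sym (inj₂ x) (inj₂ y) = adj-sym G₂ x y

  e-irrefl : ∀ x → e x x ≡ false
  e-irrefl (inj₁ x) = adj-irrefl G₁ x
  e-irrefl (inj₂ x) = adj-irrefl G₂ x

-- The disjoint union of n copies of G; the label (c , x) is the vertex x of copy c.
_·_ : ℕ → Graph → Graph
n · G = labelled {n * order G} (remQuot {n} (order G)) e e-sym e-irrefl
  where
  e : Fin n × Vertex G → Fin n × Vertex G → Bool
  e (c , x) (d , y) = does (c Fin.≟ d) ∧ adj G x y

  e-sym : ∀ x y → e x y ≡ e y x
  e-sym (c , x) (d , y) = cong₂ _∧_ (=ᵇ-sym c d) (adj-sym G x y)

  e-irrefl : ∀ x → e x x ≡ false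
  e-irrefl (c , x) = cong₂ _∧_ (dec-true (c Fin.≟ c) refl) (adj-irrefl G x)

-- Adds k new vertices to G, the i-th being adjacent to base i only.
attachPendants : (G : Graph) (k : ℕ) → (Fin k → Vertex G) → Graph
attachPendants G k base = labelled (splitAt (order G) {k}) e e-sym e-irrefl
  where
  e : Vertex G ⊎ Fin k → Vertex G ⊎ Fin k → Bool
  e (inj₁ x) (inj₁ y) = adj G x y
  e (inj₁ x) (inj₂ i) = does (x Fin.≟ base i)
  e (inj₂ i) (inj₁ x) = does (x Fin.≟ base i)
  e (inj₂ _) (inj₂ _) = false

  e-sym : ∀ x y → e x y ≡ e y x
  e-sym (inj₁ x) (inj₁ y) = adj-sym G x y
  e-sym (inj₁ _) (inj₂ _) = refl
  e-sym (inj₂ _) (inj₁ _) = refl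
  e-sym (inj₂ _) (inj₂ _) = refl

  e-irrefl : ∀ x → e x x ≡ false
  e-irrefl (inj₁ x) = adj-irrefl G x
  e-irrefl (inj₂ _) = refl

-- In K[ 1 , n ] the vertex 0 is the centre and 1 ↑ʳ i is the i-th leaf.
K*[1,_] : ℕ → Graph
K*[1, n ] = attachPendants K[ 1 , n ] n (1 ↑ʳ_)

{-# OPTIONS --safe #-}

-- For the hard direction, choose for every vertex of degree at least 2 a cherry: the vertex
-- together with two of its neighbours.  By Ramsey's theorem for pairs, a long enough list of
-- cherries has a sublist in which the equalities and adjacencies between corners p and q of the
-- i-th and j-th cherries, i < j, do not depend on i and j.  The centres are then distinct, and
-- each leaf is either shared by all cherries or different in all of them.  Corners of one varying
-- kind are independent (otherwise K n), and distinct cherries have no edges between varying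
-- corners (otherwise K[ 2 , n ]).  Two shared leaves give K[ 2 , n ] or K 2 +ᵍ n · K 1, one
-- gives K*[1, n ] or K 1 +ᵍ n · K 2, and none gives n · P 3 or n · K 3.
module Submission where

open import Defs
open import Axiom.ExcludedMiddle using (ExcludedMiddle)
open import Data.List using (_∷_; [])
open import Data.List.Membership.Propositional using (_∈_)
open import Data.Nat using (_≤_; _<_)
open import Data.Product using (∃; _×_)
open import Function.Bundles using (_⇔_)

open import Data.Bool using (Bool; true; false; not; _∧_)
import Data.Bool as Bool
open import Data.Empty using (⊥; ⊥-elim)
open import Data.Fin using (Fin; zero; suc; splitAt; remQuot; combine; join; inject≤; _↑ˡ_; _↑ʳ_)
import Data.Fin as Fin
open import Data.Fin.Patterns using (0F; 1F; 2F)
open import Data.Fin.Properties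
  using (injective⇒≤; inject≤-injective; toℕ-inject≤; suc-injective; join-splitAt; splitAt-↑ˡ; splitAt-↑ʳ;
         ↑ˡ-injective; ↑ʳ-injective;
         combine-remQuot; remQuot-combine; combine-injectiveˡ; combine-injectiveʳ; <-cmp)
open import Data.Vec using (tabulate)
open import Data.Fin.Subset using (∣_∣)
open import Data.List using (List; length; lookup; filter; allFin; cartesianProduct)
open import Data.List.Membership.Propositional.Properties
  using (∈-cartesianProduct⁺; ∈-allFin; ∈-lookup)
open import Data.List.Properties using (length-tabulate)
open import Data.List.Relation.Binary.Sublist.Propositional
  using (_⊆_; []; _∷_; _∷ʳ_; ⊆-refl; ⊆-trans; minimum)
open import Data.List.Relation.Binary.Sublist.Propositional.Properties using (All-resp-⊆; filter-⊆)
open import Data.List.Relation.Unary.All as All using (All; []; _∷_)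
open import Data.List.Relation.Unary.All.Properties using (all-filter)
open import Data.List.Relation.Unary.AllPairs using (AllPairs; []; _∷_)
open import Data.List.Relation.Unary.Unique.Propositional.Properties using (allFin⁺)
open import Data.Nat using (ℕ; zero; suc; _+_; _*_; z≤n; s≤s; s≤s⁻¹; s<s; z<s; _≤?_)
open import Data.Nat.Properties
  using (≤-reflexive; ≤-trans; +-mono-≤-<; +-suc; ≰⇒>; <⇒≤; <⇒≱; m≤n+m)
open import Data.Product using (_,_; ∃₂; proj₁; proj₂; uncurry)
open import Data.Sum using (_⊎_; inj₁; inj₂; [_,_])
open import Function using (_∘_; id; mk⇔)
open import Function.Definitions using (Injective)
open import Relation.Binary.Definitions using (tri<; tri≈; tri>)
open import Relation.Binary.PropositionalEquality hiding ([_])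
open import Relation.Nullary using (¬_; Dec; yes; no; does; contradiction)
open import Relation.Nullary.Decidable using (dec-true; decidable-stable)

private variable
  m n : ℕ
  A B I V : Set

does-true : (a? : Dec A) → does a? ≡ true → A
does-true (yes a) _ = a

does-false : (a? : Dec A) → does a? ≡ false → ¬ A
does-false (no ¬a) _ = ¬a

-- Counting

-- Translates between a subset's cardinality and its elements: completeness yields lower bounds on
-- cardinalities, while injectivity and soundness extract distinct vertices from a large count.
enumerate : ∀ {n} (p : Fin n → Bool) →
  ∃ λ (f : Fin ∣ tabulate p ∣ → Fin n) →
    Injective _≡_ _≡_ f × (∀ i → p (f i) ≡ true) × (∀ x → p x ≡ true → ∃ λ i → f i ≡ x)
enumerate {zero} p = (λ ()) , (λ { {()} }) , (λ ()) , λ ()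
enumerate {suc n} p with p zero in eq | enumerate (p ∘ suc)
... | false | f , inj , sound , complete =
  suc ∘ f , inj ∘ suc-injective , sound ,
  λ { zero p0 → contradiction (trans (sym eq) p0) λ ()
    ; (suc x) px → let i , fi≡x = complete x px in i , cong suc fi≡x }
... | true | f , inj , sound , complete =
  f′ , inj′ , (λ { zero → eq ; (suc i) → sound i }) ,
  λ { zero _ → zero , refl
    ; (suc x) px → let i , fi≡x = complete x px in suc i , cong suc fi≡x }
  where
  f′ : Fin (suc _) → Fin (suc n)
  f′ zero    = zero
  f′ (suc i) = suc (f i)

  inj′ : Injective _≡_ _≡_ f′
  inj′ {zero}  {zero}  _  = refl
  inj′ {zero}  {suc _} ()
  inj′ {suc _} {zero}  ()
  inj′ {suc _} {suc _} eq = cong suc (inj (suc-injective eq))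

injective⇒≤∣tabulate∣ : (p : Fin n → Bool) (f : Fin m → Fin n) →
  Injective _≡_ _≡_ f → (∀ i → p (f i) ≡ true) → m ≤ ∣ tabulate p ∣
injective⇒≤∣tabulate∣ p f f-inj pf =
  let e , _ , _ , complete = enumerate p
      index = λ i → complete (f i) (pf i)
  in injective⇒≤ {f = proj₁ ∘ index} λ {i} {j} eq →
       f-inj (trans (sym (proj₂ (index i))) (trans (cong e eq) (proj₂ (index j))))

-- Counting by injections is used twice: `g i` and `h i` embed `Fin 2` into the neighbourhood of
-- `f i`, and `f` embeds `Fin m` into the vertices of degree at least 2.
≤#deg≥2 : ∀ G (f g h : Fin m → Vertex G) → Injective _≡_ _≡_ f → (∀ i → g i ≢ h i) →
  (∀ i → adj G (f i) (g i) ≡ true) → (∀ i → adj G (f i) (h i) ≡ true) → m ≤ #deg≥2 G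
≤#deg≥2 G f g h f-inj g≢h f~g f~h =
  injective⇒≤∣tabulate∣ _ f f-inj λ i → dec-true (2 ≤? deg G (f i)) (2≤deg i)
  where
  2≤deg : ∀ i → 2 ≤ deg G (f i)
  2≤deg i = injective⇒≤∣tabulate∣ (adj G (f i)) (λ { 0F → g i ; 1F → h i })
    (λ { {0F} {0F} _ → refl ; {0F} {1F} eq → contradiction eq (g≢h i)
       ; {1F} {0F} eq → contradiction (sym eq) (g≢h i) ; {1F} {1F} _ → refl })
    (λ { 0F → f~g i ; 1F → f~h i })

-- Vertices of degree at least 2 in the seven graphs

adj-copy : ∀ n H (i : Fin n) x y →
  adj (n · H) (combine i x) (combine i y) ≡ adj H x y
adj-copy n H i x y = trans
  (cong₂ (λ (j , x) (k , y) → does (j Fin.≟ k) ∧ adj H x y)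
    (remQuot-combine i x) (remQuot-combine i y))
  (cong (_∧ adj H x y) (dec-true (i Fin.≟ i) refl))

unavoidable : ℕ → List Graph
unavoidable n = K n ∷ n · P 3 ∷ n · K 3 ∷ K*[1, n ] ∷ K[ 2 , n ] ∷ K 2 +ᵍ n · K 1 ∷ K 1 +ᵍ n · K 2 ∷ []

-- The offset 3 is for `K N`, where a vertex has two further vertices only if `N` is at least 3.
-- Each other graph has one vertex with two evident neighbours for every index below `N`.
unavoidable-≤#deg≥2 : ∀ k → All (λ H → 3 + k ≤ #deg≥2 H) (unavoidable (3 + k))
unavoidable-≤#deg≥2 k =
    ≤#deg≥2 (K N) id (λ { 0F → 1F ; (suc _) → 0F })
      (λ { 0F → 2F ; 1F → 2F ; (suc (suc _)) → 1F }) id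
      (λ { 0F () ; 1F () ; (suc (suc _)) () })
      (λ { 0F → refl ; (suc _) → refl }) (λ { 0F → refl ; 1F → refl ; (suc (suc _)) → refl })
  ∷ copies (P 3) 1F 0F 2F (λ ()) refl refl
  ∷ copies (K 3) 1F 0F 2F (λ ()) refl refl
  ∷ ≤#deg≥2 K*[1, N ] (λ i → suc i ↑ˡ N) (λ _ → 0F) (suc N ↑ʳ_)
      (λ eq → suc-injective (↑ˡ-injective N _ _ eq)) (λ _ ()) leaf~centre leaf~pendant
  ∷ ≤#deg≥2 K[ 2 , N ] (2 ↑ʳ_) (λ _ → 0F) (λ _ → 1F)
      (λ { refl → refl }) (λ _ ()) (λ _ → refl) (λ _ → refl)
  ∷ ≤#deg≥2 (K 2 +ᵍ N · K 1) (λ i → 2 ↑ʳ combine {n = 1} i 0F) (λ _ → 0F) (λ _ → 1F)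
      (λ eq → combine-inj {1} 0F (↑ʳ-injective 2 _ _ eq)) (λ _ ()) (λ _ → refl) (λ _ → refl)
  ∷ ≤#deg≥2 (K 1 +ᵍ N · K 2) (λ i → 1 ↑ʳ combine {n = 2} i 0F) (λ _ → 0F)
      (λ i → 1 ↑ʳ combine {n = 2} i 1F)
      (λ eq → combine-inj {2} 0F (↑ʳ-injective 1 _ _ eq)) (λ _ ()) (λ _ → refl)
      (λ i → adj-copy N (K 2) i 0F 1F)
  ∷ []
  where
  N : ℕ
  N = 3 + k

  leaf~centre : ∀ i → adj K*[1, N ] (suc i ↑ˡ N) 0F ≡ true
  leaf~centre i rewrite splitAt-↑ˡ N i N = refl

  leaf~pendant : ∀ i → adj K*[1, N ] (suc i ↑ˡ N) (suc N ↑ʳ i) ≡ true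
  leaf~pendant i rewrite splitAt-↑ˡ (suc N) (suc i) N | splitAt-↑ʳ (suc N) N i =
    dec-true (i Fin.≟ i) refl

  combine-inj : ∀ {l} (x : Fin l) {i j : Fin N} → combine i x ≡ combine j x → i ≡ j
  combine-inj x {i} {j} = combine-injectiveˡ i x j x

  copies : ∀ H (x y z : Vertex H) → y ≢ z → adj H x y ≡ true → adj H x z ≡ true → N ≤ #deg≥2 (N · H)
  copies H x y z y≢z x~y x~z =
    ≤#deg≥2 (N · H) (λ i → combine i x) (λ i → combine i y) (λ i → combine i z)
      (combine-inj x) (λ i eq → y≢z (combine-injectiveʳ i y i z eq))
      (λ i → trans (adj-copy N H i x y) x~y) (λ i → trans (adj-copy N H i x z) x~z)

-- Induced subgraphs

≤ᵍ-trans : ∀ {G₁ G₂ G₃} → G₁ ≤ᵍ G₂ → G₂ ≤ᵍ G₃ → G₁ ≤ᵍ G₃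
≤ᵍ-trans φ ψ = record
  { embed     = ψ.embed ∘ φ.embed
  ; injective = φ.injective ∘ ψ.injective
  ; induced   = λ i j → trans (ψ.induced (φ.embed i) (φ.embed j)) (φ.induced i j)
  }
  where
  module φ = _≤ᵍ_ φ
  module ψ = _≤ᵍ_ ψ

adj⇒≢ : ∀ G {x y} → adj G x y ≡ true → x ≢ y
adj⇒≢ G {x} x~x refl = contradiction (trans (sym x~x) (adj-irrefl G x)) λ ()

splitAt-injective : ∀ m {n} → Injective _≡_ _≡_ (splitAt m {n})
splitAt-injective m {n} {i} {j} eq =
  trans (sym (join-splitAt m n i)) (trans (cong (join m n) eq) (join-splitAt m n j))

remQuot-injective : ∀ {m} n → Injective _≡_ _≡_ (remQuot {m} n)
remQuot-injective {m} n {i} {j} eq =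
  trans (sym (combine-remQuot {m} n i))
    (trans (cong (uncurry combine) eq) (combine-remQuot {m} n j))

[,]-injective : {f : A → V} {g : B → V} → Injective _≡_ _≡_ f → Injective _≡_ _≡_ g →
  (∀ x y → f x ≢ g y) → Injective _≡_ _≡_ [ f , g ]
[,]-injective f-inj g-inj f≢g {inj₁ _} {inj₁ _} eq = cong inj₁ (f-inj eq)
[,]-injective f-inj g-inj f≢g {inj₁ x} {inj₂ y} eq = contradiction eq (f≢g x y)
[,]-injective f-inj g-inj f≢g {inj₂ x} {inj₁ y} eq = contradiction (sym eq) (f≢g y x)
[,]-injective f-inj g-inj f≢g {inj₂ _} {inj₂ _} eq = cong inj₂ (g-inj eq)

module _ (G : Graph) where

  -- Lets an embedding be given on structured labels, such as sums for joins and pairs for copies,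
  -- instead of on their codes in `Fin`.
  labelled-≤ᵍ : ∀ {H} (label : Vertex H → V) → Injective _≡_ _≡_ label →
    (f : V → Vertex G) → Injective _≡_ _≡_ f →
    (∀ i j → adj G (f (label i)) (f (label j)) ≡ adj H i j) → H ≤ᵍ G
  labelled-≤ᵍ label label-inj f f-inj f-adj = record
    { embed     = f ∘ label
    ; injective = label-inj ∘ f-inj
    ; induced   = f-adj
    }

  -- Injectivity comes for free, since adjacent vertices are distinct.
  K-≤ᵍ : (f : Fin n → Vertex G) → (∀ i j → i ≢ j → adj G (f i) (f j) ≡ true) → K n ≤ᵍ G
  K-≤ᵍ f f~f = record
    { embed     = f
    ; injective = inj
    ; induced   = ind
    }
    where
    inj : Injective _≡_ _≡_ f
    inj {i} {j} eq with i Fin.≟ j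
    ... | yes i≡j = i≡j
    ... | no  i≢j = contradiction eq (adj⇒≢ G (f~f i j i≢j))

    ind : ∀ i j → adj G (f i) (f j) ≡ not (does (i Fin.≟ j))
    ind i j with i Fin.≟ j
    ... | yes refl = adj-irrefl G (f i)
    ... | no  i≢j  = f~f i j i≢j

  -- Repeated values are allowed, as no vertex is adjacent to itself; injectivity is therefore a
  -- separate matter.
  Independent : (Fin n → Vertex G) → Set
  Independent f = ∀ i j → adj G (f i) (f j) ≡ false

  K[,]-≤ᵍ : ∀ {s t} (f : Fin s → Vertex G) (g : Fin t → Vertex G) →
    Injective _≡_ _≡_ f → Injective _≡_ _≡_ g → Independent f → Independent g →
    (∀ i j → adj G (f i) (g j) ≡ true) → K[ s , t ] ≤ᵍ G
  K[,]-≤ᵍ {s} {t} f g f-inj g-inj f≁f g≁g f~g =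
    labelled-≤ᵍ (splitAt s) (splitAt-injective s) [ f , g ]
      ([,]-injective f-inj g-inj λ i j → adj⇒≢ G (f~g i j)) ind
    where
    ind : ∀ i j → adj G ([ f , g ] (splitAt s i)) ([ f , g ] (splitAt s j)) ≡ adj K[ s , t ] i j
    ind i j with splitAt s {t} i | splitAt s {t} j
    ... | inj₁ i | inj₁ j = f≁f i j
    ... | inj₁ i | inj₂ j = f~g i j
    ... | inj₂ i | inj₁ j = trans (adj-sym G _ _) (f~g j i)
    ... | inj₂ i | inj₂ j = g≁g i j

  +ᵍ-≤ᵍ : ∀ {G₁ G₂} (φ : G₁ ≤ᵍ G) (ψ : G₂ ≤ᵍ G) →
    (∀ x y → adj G (_≤ᵍ_.embed φ x) (_≤ᵍ_.embed ψ y) ≡ true) → G₁ +ᵍ G₂ ≤ᵍ G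
  +ᵍ-≤ᵍ {G₁} {G₂} φ ψ φ~ψ =
    labelled-≤ᵍ (splitAt (order G₁)) (splitAt-injective (order G₁)) [ φ.embed , ψ.embed ]
      ([,]-injective φ.injective ψ.injective λ x y → adj⇒≢ G (φ~ψ x y)) ind
    where
    module φ = _≤ᵍ_ φ
    module ψ = _≤ᵍ_ ψ

    ind : ∀ i j → adj G ([ φ.embed , ψ.embed ] (splitAt (order G₁) i))
                      ([ φ.embed , ψ.embed ] (splitAt (order G₁) j))
              ≡ adj (G₁ +ᵍ G₂) i j
    ind i j with splitAt (order G₁) {order G₂} i | splitAt (order G₁) {order G₂} j
    ... | inj₁ x | inj₁ y = φ.induced x y
    ... | inj₁ x | inj₂ y = φ~ψ x y
    ... | inj₂ x | inj₁ y = trans (adj-sym G _ _) (φ~ψ y x)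
    ... | inj₂ x | inj₂ y = ψ.induced x y

  ·-≤ᵍ : ∀ {H} (f : Fin n → Vertex H → Vertex G) → (∀ i → Injective _≡_ _≡_ (f i)) →
    (∀ i j → i ≢ j → ∀ x y → f i x ≢ f j y) →
    (∀ i x y → adj G (f i x) (f i y) ≡ adj H x y) →
    (∀ i j → i ≢ j → ∀ x y → adj G (f i x) (f j y) ≡ false) → n · H ≤ᵍ G
  ·-≤ᵍ {n} {H} f f-inj f≢f f-adj f≁f =
    labelled-≤ᵍ (remQuot {n} (order H)) (remQuot-injective {n} (order H)) (uncurry f) inj
      λ i j → ind (remQuot {n} (order H) i) (remQuot {n} (order H) j)
    where
    inj : Injective _≡_ _≡_ (uncurry f)
    inj {i , x} {j , y} eq with i Fin.≟ j
    ... | yes refl = cong (i ,_) (f-inj i eq)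
    ... | no  i≢j  = contradiction eq (f≢f i j i≢j x y)

    ind : ∀ u v → adj G (uncurry f u) (uncurry f v) ≡
      does (proj₁ u Fin.≟ proj₁ v) ∧ adj H (proj₂ u) (proj₂ v)
    ind (i , x) (j , y) with i Fin.≟ j
    ... | yes refl = f-adj i x y
    ... | no  i≢j  = f≁f i j i≢j x y

  attachPendants-≤ᵍ : ∀ {H k base} (φ : H ≤ᵍ G) (g : Fin k → Vertex G) →
    Injective _≡_ _≡_ g → Independent g → (∀ x i → _≤ᵍ_.embed φ x ≢ g i) →
    (∀ x i → adj G (_≤ᵍ_.embed φ x) (g i) ≡ does (x Fin.≟ base i)) → attachPendants H k base ≤ᵍ G
  attachPendants-≤ᵍ {H} {k} {base} φ g g-inj g≁g φ≢g φ-g =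
    labelled-≤ᵍ (splitAt (order H)) (splitAt-injective (order H)) [ φ.embed , g ]
      ([,]-injective φ.injective g-inj φ≢g) ind
    where
    module φ = _≤ᵍ_ φ

    ind : ∀ i j → adj G ([ φ.embed , g ] (splitAt (order H) i))
                      ([ φ.embed , g ] (splitAt (order H) j))
              ≡ adj (attachPendants H k base) i j
    ind i j with splitAt (order H) {k} i | splitAt (order H) {k} j
    ... | inj₁ x | inj₁ y = φ.induced x y
    ... | inj₁ x | inj₂ i = φ-g x i
    ... | inj₂ i | inj₁ x = trans (adj-sym G _ _) (φ-g x i)
    ... | inj₂ i | inj₂ j = g≁g i j

-- Ramsey's theorem

AllPairs-resp-⊆ : {R : A → A → Set} {xs ys : List A} → xs ⊆ ys → AllPairs R ys → AllPairs R xs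
AllPairs-resp-⊆ []           []         = []
AllPairs-resp-⊆ (_ ∷ʳ τ)     (_ ∷ rs)   = AllPairs-resp-⊆ τ rs
AllPairs-resp-⊆ (refl ∷ τ)   (r ∷ rs)   = All-resp-⊆ τ r ∷ AllPairs-resp-⊆ τ rs

lookup-AllPairs : {R : A → A → Set} {xs : List A} → AllPairs R xs →
  ∀ {i j} → i Fin.< j → R (lookup xs i) (lookup xs j)
lookup-AllPairs {xs = _ ∷ xs} (r ∷ _)  {zero}  {suc j} _   = All.lookup r (∈-lookup {xs = xs} j)
lookup-AllPairs               (_ ∷ rs) {suc _} {suc _} i<j = lookup-AllPairs rs (s≤s⁻¹ i<j)

+-≤-split : ∀ {a b c d} → a + b ≤ c + d → a ≤ c ⊎ b ≤ d
+-≤-split {a} {b} {c} {d} le with a ≤? c | b ≤? d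
... | yes a≤c | _       = inj₁ a≤c
... | no  _   | yes b≤d = inj₂ b≤d
... | no  a≰c | no  b≰d = contradiction le (<⇒≱ (+-mono-≤-< (<⇒≤ (≰⇒> a≰c)) (≰⇒> b≰d)))

Monochromatic : (A → A → Bool) → Bool → List A → Set
Monochromatic c b = AllPairs (λ x y → c x y ≡ b)

-- The Erdős-Szekeres recursion for upper bounds on two-colour Ramsey numbers; the successor pays
-- for the element chosen first.
R₂ : ℕ → ℕ → ℕ
R₂ zero    _       = 0
R₂ (suc _) zero    = 0
R₂ (suc s) (suc t) = suc (R₂ s (suc t) + R₂ (suc s) t)

length-filter-≟ : (p : A → Bool) (xs : List A) →
  length xs ≡ length (filter (λ x → p x Bool.≟ true) xs)
            + length (filter (λ x → p x Bool.≟ false) xs)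
length-filter-≟ p []       = refl
length-filter-≟ p (x ∷ xs) with p x
... | true  = cong suc (length-filter-≟ p xs)
... | false = trans (cong suc (length-filter-≟ p xs)) (sym (+-suc _ _))

-- The head `x` splits the tail by the colour `c x y`, and one part is long enough to recurse on. A
-- sublist found there in the colour of that part is extended by `x`. Only pairs in list order are
-- coloured, so `c` may be asymmetric.
ramsey₂ : (c : A → A → Bool) → ∀ s t xs → R₂ s t ≤ length xs →
  ∃ λ ys → ys ⊆ xs ×
    (s ≤ length ys × Monochromatic c true ys ⊎ t ≤ length ys × Monochromatic c false ys)
ramsey₂ c zero    _       xs _ = [] , minimum xs , inj₁ (z≤n , [])
ramsey₂ c (suc _) zero    xs _ = [] , minimum xs , inj₂ (z≤n , [])
ramsey₂ c (suc s) (suc t) (x ∷ xs) (s≤s le)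
  with +-≤-split {R₂ s (suc t)} (≤-trans le (≤-reflexive (length-filter-≟ (c x) xs)))
... | inj₁ big with ramsey₂ c s (suc t) (filter (λ y → c x y Bool.≟ true) xs) big
...   | ys , τ , inj₂ mono        = ys , x ∷ʳ ⊆-trans τ (filter-⊆ _ xs) , inj₂ mono
...   | ys , τ , inj₁ (le , mono) =
  x ∷ ys , refl ∷ ⊆-trans τ (filter-⊆ _ xs) , inj₁ (s≤s le , All-resp-⊆ τ (all-filter _ xs) ∷ mono)
ramsey₂ c (suc s) (suc t) (x ∷ xs) (s≤s le)
    | inj₂ big with ramsey₂ c (suc s) t (filter (λ y → c x y Bool.≟ false) xs) big
...   | ys , τ , inj₁ mono        = ys , x ∷ʳ ⊆-trans τ (filter-⊆ _ xs) , inj₁ mono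
...   | ys , τ , inj₂ (le , mono) =
  x ∷ ys , refl ∷ ⊆-trans τ (filter-⊆ _ xs) , inj₂ (s≤s le , All-resp-⊆ τ (all-filter _ xs) ∷ mono)

ramsey₂-diagonal : (c : A → A → Bool) → ∀ m xs → R₂ m m ≤ length xs →
  ∃₂ λ b ys → ys ⊆ xs × m ≤ length ys × Monochromatic c b ys
ramsey₂-diagonal c m xs le with ramsey₂ c m m xs le
... | ys , τ , inj₁ mono = true  , ys , τ , mono
... | ys , τ , inj₂ mono = false , ys , τ , mono

-- The colouring at the head is treated first, so it must leave a sublist long enough for all the
-- others.
ramseyBound : List I → ℕ → ℕ
ramseyBound []       m = m
ramseyBound (_ ∷ ks) m = R₂ (ramseyBound ks m) (ramseyBound ks m)

-- Colourings are made homogeneous one after another; passing to a further sublist preserves what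
-- was already achieved.
ramsey-list : (c : I → A → A → Bool) → ∀ ks m xs → ramseyBound ks m ≤ length xs →
  ∃ λ ys → ys ⊆ xs × m ≤ length ys × All (λ k → ∃ λ b → Monochromatic (c k) b ys) ks
ramsey-list c []       m xs le = xs , ⊆-refl , le , []
ramsey-list c (k ∷ ks) m xs le
  with b , ys , τ , le′ , mono ← ramsey₂-diagonal (c k) _ xs le
  with zs , σ , le″ , monos ← ramsey-list c ks m ys le′ =
  zs , ⊆-trans σ τ , le″ , (b , AllPairs-resp-⊆ σ mono) ∷ monos

ramsey : (c : I → Fin n → Fin n → Bool) → ∀ ks m → ramseyBound ks m ≤ n →
  ∃ λ (f : Fin m → Fin n) → (∀ {i j} → i Fin.< j → f i ≢ f j) ×
    (∀ {k} → k ∈ ks → ∃ λ b → ∀ {i j} → i Fin.< j → c k (f i) (f j) ≡ b)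
ramsey {n = n} c ks m le
  with ys , τ , le′ , monos ← ramsey-list c ks m (allFin n)
    (≤-trans le (≤-reflexive (sym (length-tabulate id)))) =
  (λ i → lookup ys (inject≤ i le′)) ,
  (λ i<j → lookup-AllPairs (AllPairs-resp-⊆ τ (allFin⁺ n)) (inject≤-< i<j)) ,
  (λ k∈ks → let b , mono = All.lookup monos k∈ks in
    b , λ i<j → lookup-AllPairs mono (inject≤-< i<j))
  where
  inject≤-< : ∀ {i j : Fin m} → i Fin.< j → inject≤ i le′ Fin.< inject≤ j le′
  inject≤-< {i} {j} = subst₂ _<_ (sym (toℕ-inject≤ i le′)) (sym (toℕ-inject≤ j le′))

-- Homogeneous families of cherries

-- The corners are numbered like the vertices of `P 3`, with the centre in the middle, so that the
-- identity on `Fin 3` later serves as the embedding of `P 3` or `K 3`.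
record Cherry (G : Graph) (centre : Vertex G) : Set where
  field
    corner     : Fin 3 → Vertex G
    corner-inj : Injective _≡_ _≡_ corner
    corner-1   : corner 1F ≡ centre
    spoke      : ∀ {p} → p ≢ 1F → adj G (corner 1F) (corner p) ≡ true

2≤deg⇒Cherry : ∀ G v → 2 ≤ deg G v → Cherry G v
2≤deg⇒Cherry G v 2≤deg with f , f-inj , f-adj , _ ← enumerate (adj G v) = record
  { corner = corner ; corner-inj = corner-inj ; corner-1 = refl ; spoke = spoke }
  where
  leaf : Fin 2 → Vertex G
  leaf i = f (inject≤ i 2≤deg)

  corner : Fin 3 → Vertex G
  corner 0F = leaf 0F
  corner 1F = v
  corner 2F = leaf 1F

  v≢leaf : ∀ i → v ≢ leaf i
  v≢leaf i = adj⇒≢ G (f-adj (inject≤ i 2≤deg))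

  leaf-inj : ∀ {i j} → leaf i ≡ leaf j → i ≡ j
  leaf-inj eq = inject≤-injective 2≤deg 2≤deg _ _ (f-inj eq)

  corner-inj : Injective _≡_ _≡_ corner
  corner-inj {0F} {0F} _  = refl
  corner-inj {0F} {1F} eq = contradiction (sym eq) (v≢leaf 0F)
  corner-inj {0F} {2F} eq = contradiction (leaf-inj eq) λ ()
  corner-inj {1F} {0F} eq = contradiction eq (v≢leaf 0F)
  corner-inj {1F} {1F} _  = refl
  corner-inj {1F} {2F} eq = contradiction eq (v≢leaf 1F)
  corner-inj {2F} {0F} eq = contradiction (leaf-inj eq) λ ()
  corner-inj {2F} {1F} eq = contradiction (sym eq) (v≢leaf 1F)
  corner-inj {2F} {2F} _  = refl

  spoke : ∀ {p} → p ≢ 1F → adj G v (corner p) ≡ true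
  spoke {0F} _   = f-adj _
  spoke {1F} p≢1 = contradiction refl p≢1
  spoke {2F} _   = f-adj _

-- Ramsey's theorem speaks only of `i < j`; this recovers statements about all distinct pairs.
offDiagonal : ∀ {R : Fin n → Fin n → Set} → (∀ {i j} → i Fin.< j → R i j) →
  (∀ {i j} → i Fin.< j → R j i) → ∀ i j → i ≢ j → R i j
offDiagonal r r′ i j i≢j with <-cmp i j
... | tri< i<j _ _ = r i<j
... | tri≈ _ i≡j _ = contradiction i≡j i≢j
... | tri> _ _ j<i = r′ j<i

module Homogeneous
  (G : Graph) {n : ℕ}
  (noK   : ¬ K n ≤ᵍ G)
  (noP₃  : ¬ n · P 3 ≤ᵍ G)
  (noK₃  : ¬ n · K 3 ≤ᵍ G)
  (noK*  : ¬ K*[1, n ] ≤ᵍ G)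
  (noK₂ₙ : ¬ K[ 2 , n ] ≤ᵍ G)
  (noK₂+nK₁ : ¬ K 2 +ᵍ n · K 1 ≤ᵍ G)
  (noK₁+nK₂ : ¬ K 1 +ᵍ n · K 2 ≤ᵍ G)
  -- Three indices serve as fixed witnesses in the arguments below; the other `n` carry the
  -- forbidden subgraph.
  (t : Fin (3 + n) → Fin 3 → Vertex G)
  (t-inj : ∀ i → Injective _≡_ _≡_ (t i))
  (spoke : ∀ i {p} → p ≢ 1F → adj G (t i 1F) (t i p) ≡ true)
  (centres : ∀ {i j} → i Fin.< j → t i 1F ≢ t j 1F)
  (equal  : ∀ p q → ∃ λ b → ∀ {i j} → i Fin.< j → does (t i p Fin.≟ t j q) ≡ b)
  (across : ∀ p q → ∃ λ b → ∀ {i j} → i Fin.< j → adj G (t i p) (t j q) ≡ b)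
  (within : ∀ p q → ∃ λ b → ∀ i → adj G (t i p) (t i q) ≡ b)
  where

  equal⊎distinct : ∀ p q →
    (∀ {i j} → i Fin.< j → t i p ≡ t j q) ⊎ (∀ {i j} → i Fin.< j → t i p ≢ t j q)
  equal⊎distinct p q with equal p q
  ... | true  , h = inj₁ λ {i} {j} i<j → does-true (t i p Fin.≟ t j q) (h i<j)
  ... | false , h = inj₂ λ {i} {j} i<j → does-false (t i p Fin.≟ t j q) (h i<j)

  0<1 : Fin._<_ {3 + n} {3 + n} 0F 1F
  0<1 = z<s {0}

  0<2 : Fin._<_ {3 + n} {3 + n} 0F 2F
  0<2 = z<s {1}

  1<2 : Fin._<_ {3 + n} {3 + n} 1F 2F
  1<2 = s<s (z<s {0})

  -- If t i p ≡ t j q for all i < j then t 1 p ≡ t 2 q ≡ t 0 p ≡ t 1 q.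
  corners≢< : ∀ {p q} → p ≢ q → ∀ {i j} → i Fin.< j → t i p ≢ t j q
  corners≢< {p} {q} p≢q i<j with equal⊎distinct p q
  ... | inj₁ eq = contradiction (t-inj 1F (trans (eq 1<2) (trans (sym (eq 0<2)) (eq 0<1)))) p≢q
  ... | inj₂ ne = ne i<j

  corners≢ : ∀ {p q} → p ≢ q → ∀ i j → t i p ≢ t j q
  corners≢ p≢q i j eq with i Fin.≟ j
  ... | yes refl = p≢q (t-inj i eq)
  ... | no  i≢j  =
    offDiagonal (corners≢< p≢q) (λ i<j → corners≢< (p≢q ∘ sym) i<j ∘ sym) i j i≢j eq

  Varying Constant : Fin 3 → Set
  Varying p  = ∀ i j → i ≢ j → t i p ≢ t j p
  Constant p = ∀ i → t i p ≡ t 0F p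

  varying : ∀ {p} → (∀ {i j} → i Fin.< j → t i p ≢ t j p) → Varying p
  varying p≢p = offDiagonal p≢p λ i<j → p≢p i<j ∘ sym

  varying⊎constant : ∀ p → Varying p ⊎ Constant p
  varying⊎constant p with equal⊎distinct p p
  ... | inj₁ eq = inj₂ λ { zero → refl ; (suc i) → sym (eq z<s) }
  ... | inj₂ ne = inj₁ (varying ne)

  varying-1 : Varying 1F
  varying-1 = varying centres

  -- The indices 0 and 1 are kept aside as the two-element side of K[ 2 , n ].
  tail : Fin 3 → Fin n → Vertex G
  tail p i = t (3 ↑ʳ i) p

  3↑ʳ-≢ : ∀ {i j : Fin n} → i ≢ j → 3 ↑ʳ i ≢ 3 ↑ʳ j
  3↑ʳ-≢ i≢j refl = i≢j refl

  tail-inj : ∀ {p} → Varying p → Injective _≡_ _≡_ (tail p)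
  tail-inj v {i} {j} eq with i Fin.≟ j
  ... | yes i≡j = i≡j
  ... | no  i≢j = contradiction eq (v _ _ (3↑ʳ-≢ i≢j))

  -- The other colour would make the `n` corners of the tail a clique. Their distinctness follows
  -- from adjacency, so constant corners are covered as well.
  independent : ∀ p → Independent G (λ i → t i p)
  independent p i j with across p p
  ... | true  , h = ⊥-elim (noK (K-≤ᵍ G (tail p) λ i j i≢j →
    offDiagonal {R = λ i j → adj G (t i p) (t j p) ≡ true}
      h (λ i<j → trans (adj-sym G _ _) (h i<j)) _ _ (3↑ʳ-≢ i≢j)))
  ... | false , h with i Fin.≟ j
  ...   | yes refl = adj-irrefl G (t i p)
  ...   | no  i≢j  = offDiagonal {R = λ i j → adj G (t i p) (t j p) ≡ false}
    h (λ i<j → trans (adj-sym G _ _) (h i<j)) i j i≢j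

  pair : Vertex G → Vertex G → Fin 2 → Vertex G
  pair x y 0F = x
  pair x y 1F = y

  pair-inj : ∀ {x y} → x ≢ y → Injective _≡_ _≡_ (pair x y)
  pair-inj x≢y {0F} {0F} _  = refl
  pair-inj x≢y {0F} {1F} eq = contradiction eq x≢y
  pair-inj x≢y {1F} {0F} eq = contradiction (sym eq) x≢y
  pair-inj x≢y {1F} {1F} _  = refl

  -- The pair `x`, `y` arises in two ways: as corners of one kind in cherries 0 and 1, and as two
  -- shared leaves.
  K₂ₙ : ∀ {x y p} → x ≢ y → adj G x y ≡ false → Varying p →
    (∀ i → adj G x (tail p i) ≡ true) → (∀ i → adj G y (tail p i) ≡ true) → K[ 2 , n ] ≤ᵍ G
  K₂ₙ {x} {y} {p} x≢y x≁y v x~ y~ =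
    K[,]-≤ᵍ G (pair x y) (tail p) (pair-inj x≢y) (tail-inj v) pair-indep (λ i j → independent p _ _)
      λ { 0F → x~ ; 1F → y~ }
    where
    pair-indep : Independent G (pair x y)
    pair-indep 0F 0F = adj-irrefl G x
    pair-indep 0F 1F = x≁y
    pair-indep 1F 0F = trans (adj-sym G y x) x≁y
    pair-indep 1F 1F = adj-irrefl G y

  -- Otherwise the corners `p` of cherries 0 and 1 are both adjacent to corner `q` of every later
  -- cherry, which gives `K[ 2 , n ]`.
  non-adjacent< : ∀ {p q} → Varying p → Varying q →
    ∀ {i j} → i Fin.< j → adj G (t i p) (t j q) ≡ false
  non-adjacent< {p} {q} vp vq i<j with across p q
  ... | false , h = h i<j
  ... | true  , h = ⊥-elim (noK₂ₙ (K₂ₙ {p = q} (vp 0F 1F λ ()) (independent p 0F 1F) vq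
    (λ i → h z<s) (λ i → h (s<s z<s))))

  non-adjacent : ∀ {p q} → Varying p → Varying q → ∀ i j → i ≢ j → adj G (t i p) (t j q) ≡ false
  non-adjacent {p} {q} vp vq = offDiagonal {R = λ i j → adj G (t i p) (t j q) ≡ false}
    (non-adjacent< vp vq) λ i<j → trans (adj-sym G _ _) (non-adjacent< vq vp i<j)

  -- The map `ρ` selects the corners of each cherry that form a copy of `H`; as they all vary,
  -- different copies are disjoint and have no edges between them.
  copies : ∀ {H} (ρ : Vertex H → Fin 3) → Injective _≡_ _≡_ ρ → (∀ x → Varying (ρ x)) →
    (∀ i x y → adj G (t i (ρ x)) (t i (ρ y)) ≡ adj H x y) → n · H ≤ᵍ G
  copies {H} ρ ρ-inj v ρ-adj = ·-≤ᵍ G {H = H} (λ i x → tail (ρ x) i) (λ i → ρ-inj ∘ t-inj (3 ↑ʳ i))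
    distinct
    (λ i → ρ-adj (3 ↑ʳ i)) (λ i j i≢j x y → non-adjacent (v x) (v y) _ _ (3↑ʳ-≢ i≢j))
    where
    distinct : ∀ i j → i ≢ j → ∀ x y → tail (ρ x) i ≢ tail (ρ y) j
    distinct i j i≢j x y with ρ x Fin.≟ ρ y
    ... | yes eq    rewrite eq = v y _ _ (3↑ʳ-≢ i≢j)
    ... | no  ρx≢ρy = corners≢ ρx≢ρy _ _

  -- The spokes are known, so only the pair of leaves distinguishes an induced `P 3` from a `K 3`.
  cherry-adj : (e : Fin 3 → Fin 3 → Bool) → (∀ p q → e p q ≡ e q p) → (∀ p → e p p ≡ false) →
    e 1F 0F ≡ true → e 1F 2F ≡ true → (∀ i → adj G (t i 0F) (t i 2F) ≡ e 0F 2F) →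
    ∀ i p q → adj G (t i p) (t i q) ≡ e p q
  cherry-adj e e-sym e-irrefl e₁₀ e₁₂ e₀₂ i = λ where
      0F 0F → irreflexive 0F
      0F 1F → flip spoke₀
      0F 2F → e₀₂ i
      1F 0F → spoke₀
      1F 1F → irreflexive 1F
      1F 2F → spoke₂
      2F 0F → flip (e₀₂ i)
      2F 1F → flip spoke₂
      2F 2F → irreflexive 2F
    where
    spoke₀ : adj G (t i 1F) (t i 0F) ≡ e 1F 0F
    spoke₀ = trans (spoke i λ ()) (sym e₁₀)

    spoke₂ : adj G (t i 1F) (t i 2F) ≡ e 1F 2F
    spoke₂ = trans (spoke i λ ()) (sym e₁₂)

    irreflexive : ∀ p → adj G (t i p) (t i p) ≡ e p p
    irreflexive p = trans (adj-irrefl G _) (sym (e-irrefl p))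

    flip : ∀ {p q} → adj G (t i p) (t i q) ≡ e p q → adj G (t i q) (t i p) ≡ e q p
    flip eq = trans (adj-sym G _ _) (trans eq (e-sym _ _))

  both-varying : Varying 0F → Varying 2F → ⊥
  both-varying v₀ v₂ = contradiction-from (within 0F 2F)
    where
    all-varying : ∀ p → Varying p
    all-varying 0F = v₀
    all-varying 1F = varying-1
    all-varying 2F = v₂

    contradiction-from : (∃ λ b → ∀ i → adj G (t i 0F) (t i 2F) ≡ b) → ⊥
    contradiction-from (false , h) = noP₃ (copies {P 3} id id all-varying
      (cherry-adj (adj (P 3)) (adj-sym (P 3)) (adj-irrefl (P 3)) refl refl h))
    contradiction-from (true , h) = noK₃ (copies {K 3} id id all-varying
      (cherry-adj (adj (K 3)) (adj-sym (K 3)) (adj-irrefl (K 3)) refl refl h))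

  constant-spoke : ∀ {p} → p ≢ 1F → Constant p → ∀ i → adj G (t 0F p) (tail 1F i) ≡ true
  constant-spoke {p} p≢1 c i = trans (adj-sym G _ _)
    (subst (λ x → adj G (tail 1F i) x ≡ true) (c (3 ↑ʳ i)) (spoke (3 ↑ʳ i) p≢1))

  both-constant : Constant 0F → Constant 2F → ⊥
  both-constant c₀ c₂ with adj G (t 0F 0F) (t 0F 2F) in eq
  ... | false = noK₂ₙ (K₂ₙ (corners≢ (λ ()) 0F 0F) eq varying-1
    (constant-spoke (λ ()) c₀) (constant-spoke (λ ()) c₂))
  ... | true  = noK₂+nK₁ (+ᵍ-≤ᵍ G
    (K-≤ᵍ G (pair (t 0F 0F) (t 0F 2F)) λ where
      0F 0F 0≢0 → contradiction refl 0≢0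
      0F 1F _   → eq
      1F 0F _   → trans (adj-sym G _ _) eq
      1F 1F 1≢1 → contradiction refl 1≢1)
    -- The independent set `n · K 1` consists of the centres of the cherries.
    (copies {K 1} (λ _ → 1F) (λ { {0F} {0F} _ → refl }) (λ _ → varying-1)
      (λ { i 0F 0F → adj-irrefl G _ }))
    λ { 0F j → constant-spoke (λ ()) c₀ _ ; 1F j → constant-spoke (λ ()) c₂ _ })

  -- The shared leaf takes the central role and is adjacent to all cherry centres. If it misses the
  -- varying leaves, these are pendants on the centres, giving `K*[1, n ]`; if it sees them, it is
  -- joined to `n` disjoint edges from centre to varying leaf.
  one-constant : ∀ {p q} → p ≢ 1F → q ≢ 1F → p ≢ q → Constant p → Varying q → ⊥
  one-constant {p} {q} p≢1 q≢1 p≢q cp vq with across p q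
  ... | false , h = noK* (attachPendants-≤ᵍ G star (tail q) (tail-inj vq)
    (λ i j → independent q _ _)
    (λ { zero i → corners≢ p≢q _ _ ; (suc j) i → corners≢ (q≢1 ∘ sym) _ _ })
    -- The shared leaf is represented by cherry 0, whose index lies below all those of the tail, so
    -- the colour `across p q` applies.
    λ { zero i → h z<s ; (suc j) i → matching j i })
    where
    star : K[ 1 , n ] ≤ᵍ G
    star = K[,]-≤ᵍ G (λ _ → t 0F p) (tail 1F) (λ { {0F} {0F} _ → refl }) (tail-inj varying-1)
      (λ _ _ → adj-irrefl G _) (λ i j → independent 1F _ _) (λ _ → constant-spoke p≢1 cp)

    matching : ∀ j i → adj G (tail 1F j) (tail q i) ≡ does (j Fin.≟ i)
    matching j i with j Fin.≟ i
    ... | yes refl = spoke _ q≢1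
    ... | no  j≢i  = non-adjacent varying-1 vq _ _ (3↑ʳ-≢ j≢i)
  ... | true , h = noK₁+nK₂ (+ᵍ-≤ᵍ G
    (K-≤ᵍ G (λ _ → t 0F p) λ { 0F 0F 0≢0 → contradiction refl 0≢0 })
    (copies {K 2} ρ ρ-inj ρ-varying ρ-adj)
    λ _ j → centre-edge (proj₁ (remQuot {n} 2 j)) (proj₂ (remQuot {n} 2 j)))
    where
    ρ : Fin 2 → Fin 3
    ρ 0F = 1F
    ρ 1F = q

    ρ-inj : Injective _≡_ _≡_ ρ
    ρ-inj {0F} {0F} _  = refl
    ρ-inj {0F} {1F} eq = contradiction (sym eq) q≢1
    ρ-inj {1F} {0F} eq = contradiction eq q≢1
    ρ-inj {1F} {1F} _  = refl

    ρ-varying : ∀ x → Varying (ρ x)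
    ρ-varying 0F = varying-1
    ρ-varying 1F = vq

    ρ-adj : ∀ i x y → adj G (t i (ρ x)) (t i (ρ y)) ≡ adj (K 2) x y
    ρ-adj i 0F 0F = adj-irrefl G _
    ρ-adj i 0F 1F = spoke i q≢1
    ρ-adj i 1F 0F = trans (adj-sym G _ _) (spoke i q≢1)
    ρ-adj i 1F 1F = adj-irrefl G _

    centre-edge : ∀ i x → adj G (t 0F p) (tail (ρ x) i) ≡ true
    centre-edge i 0F = constant-spoke p≢1 cp i
    centre-edge i 1F = h z<s

  impossible : ⊥
  impossible with varying⊎constant 0F | varying⊎constant 2F
  ... | inj₁ v₀ | inj₁ v₂ = both-varying v₀ v₂
  ... | inj₁ v₀ | inj₂ c₂ = one-constant (λ ()) (λ ()) (λ ()) c₂ v₀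
  ... | inj₂ c₀ | inj₁ v₂ = one-constant (λ ()) (λ ()) (λ ()) c₀ v₂
  ... | inj₂ c₀ | inj₂ c₂ = both-constant c₀ c₂

-- Unfolding the 27 colours would turn the threshold into a 27-fold iteration of R₂.
abstract
  colours : List (Fin 3 × Fin 3 × Fin 3)
  colours = cartesianProduct (allFin 3) (cartesianProduct (allFin 3) (allFin 3))

  ∈-colours : ∀ k → k ∈ colours
  ∈-colours (a , b , c) =
    ∈-cartesianProduct⁺ (∈-allFin a) (∈-cartesianProduct⁺ (∈-allFin b) (∈-allFin c))

-- The colouring of pairs of cherries and the resulting bound

colour : (G : Graph) → (Fin m → Fin 3 → Vertex G) → Fin 3 × Fin 3 × Fin 3 → Fin m → Fin m → Bool
colour G t (0F , p , q) i j = does (t i p Fin.≟ t j q)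
colour G t (1F , p , q) i j = adj G (t i p) (t j q)
-- Ignores i, hence is controlled for every j but the first; this costs one of the 4 + n indices.
colour G t (2F , p , q) i j = adj G (t j p) (t j q)

threshold : ℕ → ℕ
threshold n = ramseyBound colours (4 + n)

unavoidable-free⇒#deg≥2< : ∀ n G → All (λ H → ¬ H ≤ᵍ G) (unavoidable n) → #deg≥2 G < threshold n
unavoidable-free⇒#deg≥2< n G (noK ∷ noP₃ ∷ noK₃ ∷ noK* ∷ noK₂ₙ ∷ noK₂+nK₁ ∷ noK₁+nK₂ ∷ [])
  with threshold n ≤? #deg≥2 G
... | no  ≰# = ≰⇒> ≰#
... | yes le
  with v , v-inj , v-deg , _ ← enumerate (λ v → does (2 ≤? deg G v)) =
  ⊥-elim (impossible (ramsey (colour G corner) colours (4 + n) le))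
  where
  2≤deg : ∀ i → 2 ≤ deg G (v i)
  2≤deg i = does-true (2 ≤? deg G (v i)) (v-deg i)

  module C i = Cherry (2≤deg⇒Cherry G (v i) (2≤deg i))

  corner : Fin (#deg≥2 G) → Fin 3 → Vertex G
  corner = C.corner

  impossible : (∃ λ (f : Fin (4 + n) → Fin (#deg≥2 G)) → (∀ {i j} → i Fin.< j → f i ≢ f j) ×
    (∀ {k} → k ∈ colours → ∃ λ b → ∀ {i j} → i Fin.< j → colour G corner k (f i) (f j) ≡ b)) → ⊥
  impossible (f , f-distinct , homogeneous) =
    Homogeneous.impossible G noK noP₃ noK₃ noK* noK₂ₙ noK₂+nK₁ noK₁+nK₂
      (corner ∘ f ∘ suc) (λ i → C.corner-inj (f (suc i))) (λ i → C.spoke (f (suc i)))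
      -- Equal centres would be equal entries of the injective enumeration `v`, at distinct indices.
      (λ i<j eq → f-distinct (s<s i<j)
        (v-inj (trans (sym (C.corner-1 _)) (trans eq (C.corner-1 _)))))
      (λ p q → let b , h = homogeneous (∈-colours (0F , p , q)) in b , λ i<j → h (s<s i<j))
      (λ p q → let b , h = homogeneous (∈-colours (1F , p , q)) in b , λ i<j → h (s<s i<j))
      (λ p q → let b , h = homogeneous (∈-colours (2F , p , q)) in b , λ i → h {zero} {suc i} z<s)

corollary4p1 : ∀ {ℓ} → ExcludedMiddle ℓ → (ℋ : Family ℓ) →
    (∃ λ C → ∀ G → G isFreeOf ℋ → #deg≥2 G ≤ C)
    ⇔
    (∃ λ n → 0 < n ×
    ℋ ≤ᶠ (λ H → H ∈ ( K n ∷ n · P 3 ∷ n · K 3 ∷ K*[1, n ] ∷ K[ 2 , n ]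
    ∷ K 2 +ᵍ n · K 1 ∷ K 1 +ᵍ n · K 2 ∷ [] )))
corollary4p1 em ℋ = mk⇔
  -- With `n` equal to `3 + C`, each of the seven graphs has more than `C` vertices of degree at
  -- least 2, so it cannot be free of `ℋ`.
  (λ (C , bounded) → 3 + C , z<s , λ H H∈ →
    -- Excluded middle turns the failure of freeness, a double negation, into an actual member of
    -- `ℋ` below `H`.
    decidable-stable em λ free →
      <⇒≱ (≤-trans (m≤n+m (suc C) 2) (All.lookup (unavoidable-≤#deg≥2 C) H∈)) (bounded H free))
  -- If `G` contained one of the seven graphs, it would contain a member of `ℋ` by transitivity.
  (λ (n , _ , ℋ≤) → threshold n , λ G free →
    <⇒≤ (unavoidable-free⇒#deg≥2< n G (All.tabulate λ {H} H∈ H≤G →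
      let H₁ , H₁∈ℋ , H₁≤H = ℋ≤ H H∈ in free (H₁ , H₁∈ℋ , ≤ᵍ-trans H₁≤H H≤G))))
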